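{- Let $B$ be either $\mathbb{N}\times\mathbb{N}$ or $\mathbb{Z}\times\mathbb{Z}$. Then the Queen graph on $B$ has no infinite odd independent set.
   Context: Here $\mathbb{N}=\{1,2,3,\ldots\}$. The Queen graph on a board $B\subseteq\mathbb{Z}\times\mathbb{Z}$ has vertex set $B$, and two distinct vertices $(a,b),(a',b')$ are adjacent iff $a=a'$, or $b=b'$, or $a-a'=b-b'$, or $a-a'=b'-b$. For a graph $G=(V,E)$, $N(v)$ denotes the open neighborhood of $v$. A set $S\subseteq V$ is an odd independent set if it is independent (no two of its vertices are adjacent) and, for every vertex $v\in V\setminus S$, the set $N(v)\cap S$ is empty or of odd size. -}

module Defs where

open import Algebra.Bundles using (AbelianGroup)
import Algebra.Properties.Group as GroupProperties
open import Data.Integer.Base using (ℤ; 1ℤ; -_; _-_) renaming (_≤_ to _≤ᶻ_)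
import Data.Integer.Properties as ℤ
open import Data.List.Base using (length)
open import Data.List.Membership.Propositional using () renaming (_∈_ to _∈ˡ_)
open import Data.List.Relation.Unary.Unique.Propositional using (Unique)
open import Data.Nat.Base using (ℕ; suc; _*_)
open import Data.Product.Base using (∃-syntax; _×_; _,_)
open import Data.Sum.Base using (_⊎_; inj₁; inj₂)
open import Function.Bundles using (_⇔_)
open import Level using (Level; 0ℓ; _⊔_)
open import Relation.Binary.Core using (Rel)
open import Relation.Binary.Definitions using (Symmetric; Irreflexive)
open import Relation.Binary.PropositionalEquality
  using (_≡_; _≢_; refl; sym; cong; module ≡-Reasoning)
open import Relation.Nullary.Negation.Core using (¬_)
open import Relation.Unary using (Pred; _∈_; _∉_; _⊆_; _∩_; Empty; U; _⟨×⟩_)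

private variable
  a ℓ : Level

Odd : ℕ → Set
Odd n = ∃[ k ] n ≡ suc (2 * k)

HasSize : {A : Set a} → Pred A ℓ → ℕ → Set (a ⊔ ℓ)
HasSize {A = A} P n =
  ∃[ xs ] Unique xs × length xs ≡ n × (∀ (x : A) → x ∈ P ⇔ x ∈ˡ xs)

Finite : {A : Set a} → Pred A ℓ → Set (a ⊔ ℓ)
Finite P = ∃[ n ] HasSize P n

Infinite : {A : Set a} → Pred A ℓ → Set (a ⊔ ℓ)
Infinite P = ¬ Finite P

-- The vertices form a subset V of an ambient type, and the edges are
-- those pairs of the ambient relation _~_ with both ends in V.
record Graph (A : Set a) ℓ ℓ′ : Set (a ⊔ Level.suc (ℓ ⊔ ℓ′)) where
  field
    V        : Pred A ℓ
    _~_      : Rel A ℓ′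
    ~-sym    : Symmetric _~_
    ~-irrefl : Irreflexive _≡_ _~_

  N : A → Pred A (ℓ ⊔ ℓ′)
  N v w = w ∈ V × v ~ w

module _ {A : Set a} {ℓV ℓE : Level} (G : Graph A ℓV ℓE) where
  open Graph G

  Independent : Pred A ℓ → Set _
  Independent S = ∀ {v w} → v ∈ S → w ∈ S → ¬ (v ~ w)

  record IsOddIndependent (S : Pred A ℓ) : Set (a ⊔ ℓV ⊔ ℓE ⊔ ℓ) where
    field
      subset      : S ⊆ V
      independent : Independent S
      odd         : ∀ v → v ∈ V → v ∉ S →
                    Empty (N v ∩ S) ⊎ (∃[ n ] Odd n × HasSize (N v ∩ S) n)

Board : Set₁
Board = Pred (ℤ × ℤ) 0ℓ

-- Here ℕ starts at 1, as in ℕ×ℕ below, unlike the library type ℕ.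
ℕ⁺ : Pred ℤ 0ℓ
ℕ⁺ i = 1ℤ ≤ᶻ i

ℕ×ℕ ℤ×ℤ : Board
ℕ×ℕ = ℕ⁺ ⟨×⟩ ℕ⁺
ℤ×ℤ = U ⟨×⟩ U

QueenAdj : Rel (ℤ × ℤ) 0ℓ
QueenAdj (a , b) (a′ , b′) =
  (a , b) ≢ (a′ , b′) ×
  (a ≡ a′ ⊎ b ≡ b′ ⊎ a - a′ ≡ b - b′ ⊎ a - a′ ≡ b′ - b)

private
  flip-diff : ∀ i j k l → i - j ≡ k - l → j - i ≡ l - k
  flip-diff i j k l eq = begin
    j - i        ≡⟨ ⁻¹-anti-homo-// i j ⟨
    - (i - j)    ≡⟨ cong -_ eq ⟩
    - (k - l)    ≡⟨ ⁻¹-anti-homo-// k l ⟩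
    l - k        ∎
    where
    open ≡-Reasoning
    open GroupProperties (AbelianGroup.group ℤ.+-0-abelianGroup) using (⁻¹-anti-homo-//)

QueenAdj-sym : Symmetric QueenAdj
QueenAdj-sym {a , b} {a′ , b′} (p≢q , line) = (λ q≡p → p≢q (sym q≡p)) , flip line
  where
  flip : a ≡ a′ ⊎ b ≡ b′ ⊎ a - a′ ≡ b - b′ ⊎ a - a′ ≡ b′ - b →
         a′ ≡ a ⊎ b′ ≡ b ⊎ a′ - a ≡ b′ - b ⊎ a′ - a ≡ b - b′
  flip (inj₁ eq)               = inj₁ (sym eq)
  flip (inj₂ (inj₁ eq))        = inj₂ (inj₁ (sym eq))
  flip (inj₂ (inj₂ (inj₁ eq))) = inj₂ (inj₂ (inj₁ (flip-diff a a′ b b′ eq)))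
  flip (inj₂ (inj₂ (inj₂ eq))) = inj₂ (inj₂ (inj₂ (flip-diff a a′ b′ b eq)))

Queen : Board → Graph (ℤ × ℤ) 0ℓ 0ℓ
Queen B = record
  { V        = B
  ; _~_      = QueenAdj
  ; ~-sym    = QueenAdj-sym
  ; ~-irrefl = λ p≡q (p≢q , _) → p≢q p≡q
  }

{-# OPTIONS --safe #-}

-- Let X, Y, D, A be the indicators, over 𝔽₂, of the occupied columns, rows,
-- diagonals y − x = d and antidiagonals y + x = s.  Every line carries at most
-- one point of S, so a vertex off S on an occupied column a gives
-- Y(y) = D(y − a) + A(y + a), and dually for rows.  Comparing two occupied
-- columns a and b, the function z ↦ D(z − (a + b)) + A(z) has period b − a far
-- out; combining three occupied columns, Y, D and A are eventually periodic,
-- and three occupied rows do the same for X.  Translating a far point of S along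
-- one of its diagonals by a common period then gives a vertex off S all four of
-- whose lines are occupied, an even number.  As S need not be decidable, values
-- in 𝔽₂ are replaced by propositions up to double negation.
module Submission where

open import Algebra.Bundles using (AbelianGroup)
import Algebra.Properties.CommutativeSemigroup as CommutativeSemigroupProperties
import Algebra.Properties.Group as GroupProperties
open import Data.Bool.Base using (Bool; true; false; not; _xor_)
import Data.Bool.Properties as Bool
open import Data.Empty using (⊥)
import Data.Empty.Polymorphic as ⊥ₚ
open import Data.Integer.Base using (ℤ; +_; -[1+_]; 0ℤ; _+_; _*_; -_; _-_; ∣_∣; +≤+)
import Data.Integer.Properties as ℤ
open import Data.Integer.Tactic.RingSolver using (solve-∀)
open import Data.List.Base using (List; []; _∷_; _++_; map; upTo; deduplicate)
open import Data.List.Membership.Propositional using () renaming (_∈_ to _∈ˡ_)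
open import Data.List.Membership.Propositional.Properties
  using (++-∈⇔; ∈-++⁺ˡ; ∈-++⁺ʳ; ∈-map⁺; ∈-upTo⁺; deduplicate-∈⇔)
open import Data.List.Membership.Propositional.Properties.WithK using (unique∧set⇒bag)
open import Data.List.Properties using (length-++)
open import Data.List.Relation.Binary.BagAndSetEquality using (∼bag⇒↭)
open import Data.List.Relation.Binary.Permutation.Propositional.Properties using (↭-length)
open import Data.List.Relation.Unary.All using ([])
open import Data.List.Relation.Unary.AllPairs using ([]; _∷_)
open import Data.List.Relation.Unary.Any using (here; there)
open import Data.List.Relation.Unary.Unique.DecPropositional.Properties using (deduplicate-!)
open import Data.List.Relation.Unary.Unique.Propositional.Properties using ()
  renaming (++⁺ to Unique-++⁺)
open import Data.Nat.Base as ℕ using (ℕ; zero; suc; s≤s)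
import Data.Nat.Properties as ℕ
open import Data.Product.Base using (∃; ∃-syntax; _×_; _,_; proj₁; proj₂)
import Data.Product.Properties as Product
open import Data.Sum.Base as Sum using (_⊎_; inj₁; inj₂; [_,_]′)
open import Data.Sum.Function.Propositional using (_⊎-⇔_)
open import Data.Unit.Base using (tt)
open import Defs
open import Function.Base using (_∘_; const; id; case_of_)
open import Function.Bundles using (_⇔_; mk⇔; Equivalence)
open import Function.Properties.Equivalence using () renaming (sym to ⇔-sym; trans to ⇔-trans)
open import Level using (Level; 0ℓ; _⊔_)
open import Relation.Binary.Definitions using (DecidableEquality)
open import Relation.Binary.PropositionalEquality
  using (_≡_; _≢_; refl; sym; trans; cong; cong₂; subst)
open import Relation.Nullary.Decidable using (yes; no; _because_; ¬¬-excluded-middle)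
open import Relation.Nullary.Negation using (¬_; contradiction; ¬¬-map)
open import Relation.Nullary.Reflects using (Reflects; ofʸ; ofⁿ; det; ⊥-reflects)
open import Relation.Unary using (Pred; _∈_; _∉_; _∩_; _∪_; Empty; U; _⟨×⟩_; Satisfiable)

private variable
  a b ℓ ℓ′ ℓ″ : Level
  A B : Set a

-- Cardinalities of finite sets and of fibres.

module _ {P : Pred A ℓ} {Q : Pred A ℓ′} where

  hasSize-unique : ∀ {m n} → HasSize P m → HasSize Q n → (∀ x → x ∈ P ⇔ x ∈ Q) → m ≡ n
  hasSize-unique (xs , xs! , refl , P⇔xs) (ys , ys! , refl , Q⇔ys) P⇔Q =
    ↭-length (∼bag⇒↭ (unique∧set⇒bag xs! ys! λ {x} →
      ⇔-trans (⇔-sym (P⇔xs x)) (⇔-trans (P⇔Q x) (Q⇔ys x))))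

  hasSize-∪ : ∀ {m n} → HasSize P m → HasSize Q n → Empty (P ∩ Q) → HasSize (P ∪ Q) (m ℕ.+ n)
  hasSize-∪ (xs , xs! , refl , P⇔xs) (ys , ys! , refl , Q⇔ys) disjoint =
    xs ++ ys ,
    Unique-++⁺ xs! ys! (λ {x} (x∈xs , x∈ys) →
      disjoint x (Equivalence.from (P⇔xs x) x∈xs , Equivalence.from (Q⇔ys x) x∈ys)) ,
    length-++ xs ,
    λ x → ⇔-trans (P⇔xs x ⊎-⇔ Q⇔ys x) (⇔-sym ++-∈⇔)

-- Repetitions are allowed, so listings of overlapping sets can be concatenated without a
-- disjointness proof.
Listed : {A : Set a} → Pred A ℓ → Set (a ⊔ ℓ)
Listed P = ∃[ xs ] ∀ x → x ∈ P ⇔ x ∈ˡ xs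

listed⇒finite : DecidableEquality A → {P : Pred A ℓ} → Listed P → Finite P
listed⇒finite _≟_ (xs , P⇔xs) =
  _ , deduplicate _≟_ xs , deduplicate-! _≟_ xs , refl ,
  λ x → ⇔-trans (P⇔xs x) (deduplicate-∈⇔ _≟_)

Fibre : {A : Set a} {B : Set b} → (A → B) → B → Pred A b
Fibre f k x = f x ≡ k

Occupied : {A : Set a} {B : Set b} → Pred A ℓ → (A → B) → B → Set (a ⊔ b ⊔ ℓ)
Occupied S f k = Satisfiable (S ∩ Fibre f k)

InjectiveOn : {A : Set a} {B : Set b} → Pred A ℓ → (A → B) → Set (a ⊔ b ⊔ ℓ)
InjectiveOn S f = ∀ {x y} → x ∈ S → y ∈ S → f x ≡ f y → x ≡ y

indicator : Bool → ℕ
indicator false = 0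
indicator true  = 1

module _ {A : Set a} {B : Set b} {S : Pred A ℓ} {f : A → B} (inj : InjectiveOn S f) where

  hasSize-fibre : ∀ {k t} → Reflects (Occupied S f k) t → HasSize (S ∩ Fibre f k) (indicator t)
  hasSize-fibre (ofʸ (x , x∈S , refl)) =
    x ∷ [] , [] ∷ [] , refl ,
    λ y → mk⇔ (λ (y∈S , fy≡fx) → here (inj y∈S x∈S fy≡fx)) λ { (here refl) → x∈S , refl }
  hasSize-fibre (ofⁿ empty) =
    [] , [] , refl , λ y → mk⇔ (λ y∈ → contradiction (y , y∈) empty) λ ()

  -- Whether a fibre is occupied may be undecidable, but finitely many instances of excluded middle
  -- suffice, and one outer double negation absorbs them.
  ¬¬listed-fibres : ∀ ks → ¬ ¬ Listed (S ∩ λ x → f x ∈ˡ ks)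
  ¬¬listed-fibres [] k = k ([] , λ x → mk⇔ (λ ()) λ ())
  ¬¬listed-fibres (z ∷ ks) k = ¬¬listed-fibres ks λ (xs , ⇔xs) →
    ¬¬-excluded-middle λ (t because occupied) →
    let (ys , _ , _ , ⇔ys) = hasSize-fibre occupied in
    k (ys ++ xs , λ x → ⇔-trans
      (mk⇔ (λ { (x∈S , here eq)  → inj₁ (x∈S , eq)
              ; (x∈S , there fx∈) → inj₂ (x∈S , fx∈) })
           λ { (inj₁ (x∈S , eq))  → x∈S , here eq
             ; (inj₂ (x∈S , fx∈)) → x∈S , there fx∈ })
      (⇔-trans (⇔ys x ⊎-⇔ ⇔xs x) (⇔-sym ++-∈⇔)))

ball : ℕ → List ℤ
ball T = map +_ (upTo (suc T)) ++ map (-_ ∘ +_) (upTo (suc T))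

∈-ball : ∀ {T} z → ∣ z ∣ ℕ.≤ T → z ∈ˡ ball T
∈-ball (+ n)        n≤T = ∈-++⁺ˡ (∈-map⁺ +_ (∈-upTo⁺ (s≤s n≤T)))
∈-ball {T} -[1+ n ] n<T = ∈-++⁺ʳ (map +_ (upTo (suc T))) (∈-map⁺ (-_ ∘ +_) (∈-upTo⁺ (s≤s n<T)))

-- Each of the finitely many fibres over a bounded range holds at most one point.
¬¬far-point : DecidableEquality A → {S : Pred A ℓ} → Infinite S →
  {f g : A → ℤ} → InjectiveOn S f → InjectiveOn S g →
  ∀ T → ¬ ¬ (∃[ x ] x ∈ S × T ℕ.< ∣ f x ∣ × T ℕ.< ∣ g x ∣)
¬¬far-point _≟_ {S} infinite {f} {g} f-inj g-inj T none =
  ¬¬listed-fibres f-inj (ball T) λ (xs , ⇔xs) →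
  ¬¬listed-fibres g-inj (ball T) λ (ys , ⇔ys) →
  infinite (listed⇒finite _≟_ (xs ++ ys , λ x → ⇔-trans
    (mk⇔ near [ proj₁ , proj₁ ]′)
    (⇔-trans (⇔xs x ⊎-⇔ ⇔ys x) (⇔-sym ++-∈⇔))))
  where
  near : ∀ {x} → x ∈ S → (x ∈ S × f x ∈ˡ ball T) ⊎ (x ∈ S × g x ∈ˡ ball T)
  near {x} x∈S with T ℕ.<? ∣ f x ∣ | T ℕ.<? ∣ g x ∣
  ... | no ≮f   | _       = inj₁ (x∈S , ∈-ball (f x) (ℕ.≮⇒≥ ≮f))
  ... | yes _   | no ≮g   = inj₂ (x∈S , ∈-ball (g x) (ℕ.≮⇒≥ ≮g))
  ... | yes T<f | yes T<g = contradiction (x , x∈S , T<f , T<g) none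

-- Parity of natural numbers.

odd? : ℕ → Bool
odd? zero    = false
odd? (suc n) = not (odd? n)

odd?-+ : ∀ m n → odd? (m ℕ.+ n) ≡ odd? m xor odd? n
odd?-+ zero    n = refl
odd?-+ (suc m) n = trans (cong not (odd?-+ m n)) (Bool.not-distribˡ-xor (odd? m) (odd? n))

odd?-Odd : ∀ {n} → Odd n → odd? n ≡ true
odd?-Odd (k , refl) rewrite ℕ.+-identityʳ k = cong not (trans (odd?-+ k k) (Bool.xor-same (odd? k)))

odd?-indicator : ∀ t → odd? (indicator t) ≡ t
odd?-indicator false = refl
odd?-indicator true  = refl

-- Integer arithmetic and a common period.

≡-transport : ∀ {i j k l} → i - j ≡ k - l → i ≡ j → k ≡ l
≡-transport {i} {k = k} {l} eq refl = ℤ.i-j≡0⇒i≡j k l (trans (sym eq) (ℤ.+-inverseʳ i))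

*-nonZero : ∀ i j → i ≢ 0ℤ → j ≢ 0ℤ → i * j ≢ 0ℤ
*-nonZero i j i≢0 j≢0 = [ i≢0 , j≢0 ]′ ∘ ℤ.i*j≡0⇒i≡0∨j≡0 i

double-injective : ∀ {i j} → i + i ≡ j + j → i ≡ j
double-injective {i} {j} eq = ℤ.*-cancelˡ-≡ (+ 2) i j (trans (lemma i) (trans eq (sym (lemma j))))
  where
  lemma : ∀ i → + 2 * i ≡ i + i
  lemma = solve-∀

-- A common multiple of the pairwise differences, which appear up to sign as periods when three
-- occupied parallel lines are compared.
commonPeriod : ℤ → ℤ → ℤ → ℤ
commonPeriod a b c = (b - a) * (c - a) * (c - b)

commonPeriod-nonZero : ∀ a b c → ∣ a ∣ ℕ.< ∣ b ∣ → ∣ b ∣ ℕ.< ∣ c ∣ → commonPeriod a b c ≢ 0ℤ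
commonPeriod-nonZero a b c a<b b<c =
  *-nonZero ((b - a) * (c - a)) (c - b)
    (*-nonZero (b - a) (c - a) (difference a b a<b) (difference a c (ℕ.<-trans a<b b<c)))
    (difference b c b<c)
  where
  difference : ∀ i j → ∣ i ∣ ℕ.< ∣ j ∣ → j - i ≢ 0ℤ
  difference i j i<j j-i≡0 = ℕ.<-irrefl (cong ∣_∣ (sym (ℤ.i-j≡0⇒i≡j j i j-i≡0))) i<j

-- Eventual periodicity of functions on `ℤ`.

Far : Pred ℤ 0ℓ → ℕ → Pred ℤ 0ℓ
Far Side T z = z ∈ Side × T ℕ.< ∣ z ∣

-- `Side` is a factor of the board: far out means large and positive in the quadrant, and large in
-- absolute value in the plane.
module Eventual (Side : Pred ℤ 0ℓ) (step : ∀ k {z} → z ∈ Side → ∣ k ∣ ℕ.< ∣ z ∣ → z + k ∈ Side) where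

  Eventually : Pred ℤ ℓ → Set ℓ
  Eventually P = ∃[ T ] ∀ {z} → Far Side T z → z ∈ P

  zipWith : {P : Pred ℤ ℓ} {Q : Pred ℤ ℓ′} {R : Pred ℤ ℓ″} → (∀ z → z ∈ P → z ∈ Q → z ∈ R) →
            Eventually P → Eventually Q → Eventually R
  zipWith f (T , p) (T′ , q) = T ℕ.+ T′ , λ {z} (z∈ , far) →
    f z (p (z∈ , ℕ.≤-<-trans (ℕ.m≤m+n T T′) far)) (q (z∈ , ℕ.≤-<-trans (ℕ.m≤n+m T′ T) far))

  -- A shift by `k` costs at most `∣ k ∣` in absolute value, and the raised threshold also forces
  -- `∣ k ∣` below `∣ z ∣`, as `step` demands.
  Far-+ : ∀ k {T z} → Far Side (T ℕ.+ ∣ k ∣) z → Far Side T (z + k)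
  Far-+ k {T} {z} (z∈ , far) =
    step k z∈ (ℕ.≤-<-trans (ℕ.m≤n+m ∣ k ∣ T) far) ,
    ℕ.+-cancelʳ-< (∣ k ∣) T _ (begin-strict
      T ℕ.+ ∣ k ∣              <⟨ far ⟩
      ∣ z ∣                    ≡⟨ cong ∣_∣ (lemma z k) ⟩
      ∣ z + k - k ∣            ≤⟨ ℤ.∣i-j∣≤∣i∣+∣j∣ (z + k) k ⟩
      ∣ z + k ∣ ℕ.+ ∣ k ∣      ∎)
    where
    open ℕ.≤-Reasoning
    lemma : ∀ z k → z ≡ z + k - k
    lemma = solve-∀

  shift : ∀ k {P : Pred ℤ ℓ} → Eventually P → Eventually (λ z → z + k ∈ P)
  shift k (T , p) = T ℕ.+ ∣ k ∣ , λ far → p (Far-+ k far)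

  module Periods {c ℓ} (G : AbelianGroup c ℓ)
    (x∙x≈ε : ∀ x → AbelianGroup._≈_ G (AbelianGroup._∙_ G x x) (AbelianGroup.ε G)) where

    open AbelianGroup G hiding (_-_) renaming (sym to ≈-sym; trans to ≈-trans)
    open CommutativeSemigroupProperties commutativeSemigroup using (interchange)
    open GroupProperties group using (∙-cancelˡ)
    open import Relation.Binary.Reasoning.Setoid setoid

    -- Every element is its own inverse, so adding `x` and `y` to both sides moves each of them
    -- across the equation.
    exchange : ∀ {w x y z} → w ∙ x ≈ y ∙ z → w ∙ y ≈ x ∙ z
    exchange {w} {x} {y} {z} wx≈yz = begin
      w ∙ y              ≈⟨ identityʳ (w ∙ y) ⟨
      (w ∙ y) ∙ ε        ≈⟨ ∙-congˡ (x∙x≈ε x) ⟨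
      (w ∙ y) ∙ (x ∙ x)  ≈⟨ interchange w y x x ⟩
      (w ∙ x) ∙ (y ∙ x)  ≈⟨ ∙-congʳ wx≈yz ⟩
      (y ∙ z) ∙ (y ∙ x)  ≈⟨ interchange y z y x ⟩
      (y ∙ y) ∙ (z ∙ x)  ≈⟨ ∙-congʳ (x∙x≈ε y) ⟩
      ε ∙ (z ∙ x)        ≈⟨ identityˡ (z ∙ x) ⟩
      z ∙ x              ≈⟨ comm z x ⟩
      x ∙ z              ∎

    Period : (ℤ → Carrier) → ℤ → Set ℓ
    Period f d = Eventually (λ z → f z ≈ f (z + d))

    at : ∀ (f : ℤ → Carrier) {i j} → i ≡ j → f i ≈ f j
    at f eq = reflexive (cong f eq)

    weaken : {P Q : Pred ℤ ℓ} → (∀ z → z ∈ P → z ∈ Q) → Eventually P → Eventually Q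
    weaken f (T , p) = T , λ {z} far → f z (p far)

    period-between : ∀ f i j → Eventually (λ z → f (z + i) ≈ f (z + j)) → Period f (j - i)
    period-between f i j e = weaken
      (λ z eq → ≈-trans (at f (left z i)) (≈-trans eq (at f (right z i j))))
      (shift (- i) e)
      where
      left : ∀ z i → z ≡ z + - i + i
      left = solve-∀
      right : ∀ z i j → z + - i + j ≡ z + (j - i)
      right = solve-∀

    period-neg : ∀ f d → Period f d → Period f (- d)
    period-neg f d e = weaken
      (λ z eq → ≈-trans (at f (lemma z d)) (≈-sym eq))
      (shift (- d) e)
      where
      lemma : ∀ z d → z ≡ z + - d + d
      lemma = solve-∀

    period-*ℕ : ∀ f d → Period f d → ∀ k → Period f (+ k * d)
    period-*ℕ f d e zero    = 0 , λ {z} _ → at f (sym (ℤ.+-identityʳ z))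
    period-*ℕ f d e (suc k) = zipWith
      (λ z eq eqs → ≈-trans eq (≈-trans eqs (at f
        (trans (ℤ.+-assoc z d (+ k * d)) (cong (_+_ z) (sym (ℤ.suc-* (+ k) d)))))))
      e (shift d (period-*ℕ f d e k))

    period-* : ∀ f d → Period f d → ∀ k → Period f (k * d)
    period-* f d e (+ k)    = period-*ℕ f d e k
    period-* f d e -[1+ k ] = subst (Period f) (ℤ.neg-distribˡ-* (+ suc k) d)
      (period-neg f (+ suc k * d) (period-*ℕ f d e (suc k)))

    period-shift : ∀ f d k → Period f d → Period (λ z → f (z + k)) d
    period-shift f d k e = weaken (λ z eq → ≈-trans eq (at f (lemma z k d))) (shift k e)
      where
      lemma : ∀ z k d → z + k + d ≡ z + d + k
      lemma = solve-∀

    period-∙ : ∀ f g d → Period f d → Period g d → Period (λ z → f z ∙ g z) d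
    period-∙ f g d = zipWith (λ z → ∙-cong)

    period-resp : ∀ f g d → Eventually (λ z → f z ≈ g z) → Period f d → Period g d
    period-resp f g d f≈g e = zipWith (λ z eq → ≈-trans (≈-trans (≈-sym (proj₁ eq)) (proj₂ eq)))
      (zipWith (λ z → _,_) f≈g e) (shift d f≈g)

    -- The hypothesis equates `f z ∙ f (z + n)` with `f (z + n) ∙ f (z + n + n)`, and the shared
    -- term cancels.
    period-double : ∀ f n → Period (λ z → f z ∙ f (z + n)) n → Period f (n + n)
    period-double f n = weaken λ z eq → ≈-trans
      (∙-cancelˡ (f (z + n)) _ _ (≈-trans (comm _ _) eq))
      (at f (ℤ.+-assoc z n n))

    module _ (Y D A : ℤ → Carrier) where

      -- `y - a` and `y + a` index the diagonal and the antidiagonal through `(a , y)`. The left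
      -- side does not involve `a`, which allows different columns to be compared.
      Balanced : ℤ → Set ℓ
      Balanced a = Eventually (λ y → Y y ≈ D (y - a) ∙ A (y + a))

      -- Eliminating `Y` gives `D (y - a) ∙ A (y + a) ≈ D (y - b) ∙ A (y +
      -- b)`. Exchanging the two `D` terms makes both sides values of one function, at `z = y + a`
      -- and at `z = y + b`, because the argument of `D` is then `z - (a + b)` on each side.
      balanced-period : ∀ {a b} → Balanced a → Balanced b →
        Period (λ z → D (z - (a + b)) ∙ A z) (b - a)
      balanced-period {a} {b} = (period-between _ a b ∘_) ∘ zipWith λ y Ya Yb →
        let ab = ≈-trans (≈-sym Ya) Yb in
        ≈-trans (∙-congʳ (at D (left y a b)))
        (≈-trans (exchange (≈-trans (comm _ _) (exchange ab)))
        (∙-congʳ (at D (right y a b))))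
        where
        left : ∀ y a b → y + a - (a + b) ≡ y - b
        left = solve-∀
        right : ∀ y a b → y - a ≡ y + b - (a + b)
        right = solve-∀

      -- The difference z ↦ D z ∙ D (z + n) agrees, up to shifts by a + b and by
      -- a + c, with A z ∙ A (z + n), so it has period c − b as well.
      balanced³-periods : ∀ {a b c} → Balanced a → Balanced b → Balanced c →
        let n = commonPeriod a b c in
        Period Y (n + n) × Period D (n + n) × Period A (n + n)
      balanced³-periods {a} {b} {c} Ya Yb Yc =
        period-resp _ Y (n + n) (weaken (λ z → ≈-sym) Ya)
          (period-∙ _ _ (n + n) (period-shift D (n + n) (- a) D-period)
                                (period-shift A (n + n) a A-period)) ,
        D-period , A-period
        where
        n = commonPeriod a b c
        K : ℤ → Carrier
        K w = D w ∙ D (w + n)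
        swapped : ∀ z s n → z + n - s ≡ z - s + n
        swapped = solve-∀
        K≈ : ∀ s → Period (λ z → D (z - s) ∙ A z) n →
             Eventually (λ z → K (z - s) ≈ A z ∙ A (z + n))
        K≈ s = weaken λ z eq →
          ≈-trans (∙-congˡ (at D (sym (swapped z s n)))) (exchange eq)
        factor₁ : ∀ a b c → (c - a) * (c - b) * (b - a) ≡ (b - a) * (c - a) * (c - b)
        factor₁ = solve-∀
        factor₂ : ∀ a b c → (b - a) * (c - b) * (c - a) ≡ (b - a) * (c - a) * (c - b)
        factor₂ = solve-∀
        -- The shifts by `- (a + b)` and `- (a + c)` differ by `b - c`, hence the minus sign in the
        -- cofactor.
        factor₃ : ∀ a b c → - ((b - a) * (c - a)) * (- (a + c) - - (a + b)) ≡ (b - a) * (c - a) * (c - b)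
        factor₃ = solve-∀
        K≈ab : Eventually (λ z → K (z - (a + b)) ≈ A z ∙ A (z + n))
        K≈ab = K≈ (a + b) (subst (Period _) (factor₁ a b c)
                 (period-* _ (b - a) (balanced-period Ya Yb) ((c - a) * (c - b))))
        K≈ac : Eventually (λ z → K (z - (a + c)) ≈ A z ∙ A (z + n))
        K≈ac = K≈ (a + c) (subst (Period _) (factor₂ a b c)
                 (period-* _ (c - a) (balanced-period Ya Yc) ((b - a) * (c - b))))
        K-period : Period K n
        K-period = subst (Period K) (factor₃ a b c)
          (period-* K _
            (period-between K (- (a + b)) (- (a + c))
              (zipWith (λ z eq eq′ → ≈-trans eq (≈-sym eq′)) K≈ab K≈ac))
            (- ((b - a) * (c - a))))
        D-period : Period D (n + n)
        D-period = period-double D n K-period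
        A-period : Period A (n + n)
        A-period = period-double A n
          (period-resp _ _ n K≈ab (period-shift K n (- (a + b)) K-period))

-- Propositions form an abelian group of exponent 2 under exclusive or, once
-- equality is weakened to the double negation of having the same truth value.

module _ {ℓ : Level} where

  infix 4 _≈_
  infixr 6 _⊕_

  _≈_ : Set ℓ → Set ℓ → Set ℓ
  P ≈ Q = ¬ ¬ (∃[ t ] Reflects P t × Reflects Q t)

  -- A negated equivalence does not commit to which side holds; it agrees with exclusive or as soon
  -- as both truth values are known.
  _⊕_ : Set ℓ → Set ℓ → Set ℓ
  P ⊕ Q = ¬ (P ⇔ Q)

  ¬¬reflects : ∀ (P : Set ℓ) → ¬ ¬ (∃[ t ] Reflects P t)
  ¬¬reflects P = ¬¬-map (λ (t because r) → t , r) ¬¬-excluded-middle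

  ⊕-reflects : ∀ {P Q : Set ℓ} {s t} → Reflects P s → Reflects Q t → Reflects (P ⊕ Q) (s xor t)
  ⊕-reflects (ofʸ p)  (ofʸ q)  = ofⁿ λ P⊕Q → P⊕Q (mk⇔ (const q) (const p))
  ⊕-reflects (ofʸ p)  (ofⁿ ¬q) = ofʸ λ P⇔Q → ¬q (Equivalence.to P⇔Q p)
  ⊕-reflects (ofⁿ ¬p) (ofʸ q)  = ofʸ λ P⇔Q → ¬p (Equivalence.from P⇔Q q)
  ⊕-reflects (ofⁿ ¬p) (ofⁿ ¬q) =
    ofⁿ λ P⊕Q → P⊕Q (mk⇔ (λ p → contradiction p ¬p) (λ q → contradiction q ¬q))

  same-truth : ∀ {P Q : Set ℓ} {s t} → Reflects P s → Reflects Q t → s ≡ t → P ≈ Q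
  same-truth r r′ refl k = k (_ , r , r′)

  ≈-trans : ∀ {P Q R : Set ℓ} → P ≈ Q → Q ≈ R → P ≈ R
  ≈-trans P≈Q Q≈R k = P≈Q λ (s , p , q) → Q≈R λ (t , q′ , r) →
    same-truth p r (det q q′) k

  transfer : ∀ {P Q : Set ℓ} → P → P ≈ Q → ¬ ¬ Q
  transfer p P≈Q ¬q = P≈Q λ { (_ , ofʸ _ , ofʸ q) → ¬q q ; (_ , ofⁿ ¬p , _) → ¬p p }

  ⊕-abelianGroup : AbelianGroup (Level.suc ℓ) ℓ
  ⊕-abelianGroup = record
    { Carrier = Set ℓ ; _≈_ = _≈_ ; _∙_ = _⊕_ ; ε = ⊥ₚ.⊥ ; _⁻¹ = id
    ; isAbelianGroup = record
      { isGroup = record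
        { isMonoid = record
          { isSemigroup = record
            { isMagma = record
              { isEquivalence = record
                { refl  = λ {P} k → ¬¬reflects P λ (t , r) → k (t , r , r)
                ; sym   = ¬¬-map λ (t , p , q) → t , q , p
                ; trans = ≈-trans
                }
              ; ∙-cong = λ P≈Q R≈S k → P≈Q λ (s , p , q) → R≈S λ (t , r , u) →
                  k (s xor t , ⊕-reflects p r , ⊕-reflects q u)
              }
            ; assoc = λ P Q R k → ¬¬reflects P λ (s , p) → ¬¬reflects Q λ (t , q) →
                ¬¬reflects R λ (u , r) →
                same-truth (⊕-reflects (⊕-reflects p q) r) (⊕-reflects p (⊕-reflects q r))
                  (Bool.xor-assoc s t u) k
            }
          ; identity =
              (λ P k → ¬¬reflects P λ (t , p) →
                k (t , ⊕-reflects ⊥-reflects p , p)) ,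
              (λ P k → ¬¬reflects P λ (t , p) →
                same-truth (⊕-reflects p ⊥-reflects) p (Bool.xor-identityʳ t) k)
          }
        ; inverse = self , self
        ; ⁻¹-cong = id
        }
      ; comm = λ P Q k → ¬¬reflects P λ (s , p) → ¬¬reflects Q λ (t , q) →
          same-truth (⊕-reflects p q) (⊕-reflects q p) (Bool.xor-comm s t) k
      }
    }
    where
    self : ∀ P → P ⊕ P ≈ ⊥ₚ.⊥
    self P k = ¬¬reflects P λ (t , p) →
      same-truth (⊕-reflects p p) ⊥-reflects (Bool.xor-same t) k

-- Lines of the board and their intersections.

col row diag anti : ℤ × ℤ → ℤ
col  (x , y) = x
row  (x , y) = y
diag (x , y) = y - x
anti (x , y) = y + x

-- Coordinates that are constant along lines turn queen moves into membership in fibres. Unlike with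
-- adjacency, `v` counts as lying on its own lines.
OnLine : ℤ × ℤ → ℤ × ℤ → Set
OnLine v p = col p ≡ col v ⊎ row p ≡ row v ⊎ diag p ≡ diag v ⊎ anti p ≡ anti v

onLine⇒adjacent : ∀ {v p} → v ≢ p → OnLine v p → QueenAdj v p
onLine⇒adjacent {x , y} {x′ , y′} v≢p =
  (v≢p ,_) ∘ Sum.map sym (Sum.map sym (Sum.map
    (≡-transport (lemma₁ x y x′ y′)) (sym ∘ ≡-transport (lemma₂ x y x′ y′))))
  where
  lemma₁ : ∀ x y x′ y′ → (y′ - x′) - (y - x) ≡ (x - x′) - (y - y′)
  lemma₁ = solve-∀
  lemma₂ : ∀ x y x′ y′ → (y′ + x′) - (y + x) ≡ (y′ - y) - (x - x′)
  lemma₂ = solve-∀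

adjacent⇒onLine : ∀ {v p} → QueenAdj v p → OnLine v p
adjacent⇒onLine {x , y} {x′ , y′} (_ , line) =
  Sum.map sym (Sum.map sym (Sum.map
    (≡-transport (lemma₁ x y x′ y′)) (sym ∘ ≡-transport (lemma₂ x y x′ y′)))) line
  where
  lemma₁ : ∀ x y x′ y′ → (x - x′) - (y - y′) ≡ (y′ - x′) - (y - x)
  lemma₁ = solve-∀
  lemma₂ : ∀ x y x′ y′ → (x - x′) - (y′ - y) ≡ (y + x) - (y′ + x′)
  lemma₂ = solve-∀

private
  module ℤ+ = GroupProperties (AbelianGroup.group ℤ.+-0-abelianGroup)

module _ {v p : ℤ × ℤ} where

  -- Here and in the next five lemmas, two lines of different directions meet in at most one point.
  -- This will make the four sets of neighbours disjoint.
  col-row : col p ≡ col v → row p ≡ row v → p ≡ v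
  col-row = cong₂ _,_

  col-diag : col p ≡ col v → diag p ≡ diag v → p ≡ v
  col-diag refl eq = cong (_ ,_) (ℤ+.∙-cancelʳ (- col v) _ _ eq)

  col-anti : col p ≡ col v → anti p ≡ anti v → p ≡ v
  col-anti refl eq = cong (_ ,_) (ℤ+.∙-cancelʳ (col v) _ _ eq)

  row-diag : row p ≡ row v → diag p ≡ diag v → p ≡ v
  row-diag refl eq = cong (_, _) (ℤ.neg-injective (ℤ+.∙-cancelˡ (row v) _ _ eq))

  row-anti : row p ≡ row v → anti p ≡ anti v → p ≡ v
  row-anti refl eq = cong (_, _) (ℤ+.∙-cancelˡ (row v) _ _ eq)

  -- The diagonal and antidiagonal coordinates add up to twice the row, and doubling is injective.
  diag-anti : diag p ≡ diag v → anti p ≡ anti v → p ≡ v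
  diag-anti d a = row-anti (double-injective
    (trans (lemma (row p) (col p)) (trans (cong₂ _+_ d a) (sym (lemma (row v) (col v)))))) a
    where
    lemma : ∀ y x → y + y ≡ (y - x) + (y + x)
    lemma = solve-∀

_≟_ : DecidableEquality (ℤ × ℤ)
_≟_ = Product.≡-dec ℤ._≟_ ℤ._≟_

-- Parity conditions on the lines through a vertex off `S`.

odd-occupied-column : ∀ y w → true xor (y xor w) ≡ true → y ≡ w
odd-occupied-column false false _ = refl
odd-occupied-column true  true  _ = refl

odd-occupied-row : ∀ x w → x xor (true xor w) ≡ true → x ≡ w
odd-occupied-row false false _ = refl
odd-occupied-row true  true  _ = refl

-- A far point will be moved along one of its diagonals, which changes the index of the crossing
-- diagonal. `spread` supplies a crossing index that is itself far out, where the period applies.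
module Placement (Side : Pred ℤ 0ℓ)
  (step : ∀ k {z} → z ∈ Side → ∣ k ∣ ℕ.< ∣ z ∣ → z + k ∈ Side)
  (spread : ∀ T {x y} → Far Side T x → Far Side T y → Far Side T (y + x) ⊎ Far Side T (y - x))
  {ℓ} {S : Pred (ℤ × ℤ) ℓ} (oddIndependent : IsOddIndependent (Queen (Side ⟨×⟩ Side)) S)
  where

  open IsOddIndependent oddIndependent
  open Eventual Side step
  open Periods (⊕-abelianGroup {ℓ}) (AbelianGroup.inverseˡ ⊕-abelianGroup)

  collinear : ∀ {p q} → p ∈ S → q ∈ S → OnLine q p → p ≡ q
  collinear {p} {q} p∈S q∈S line with q ≟ p
  ... | yes q≡p = sym q≡p
  ... | no q≢p  = contradiction (onLine⇒adjacent q≢p line) (independent q∈S p∈S)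

  col-injective : InjectiveOn S col
  col-injective p∈S q∈S = collinear p∈S q∈S ∘ inj₁

  row-injective : InjectiveOn S row
  row-injective p∈S q∈S = collinear p∈S q∈S ∘ inj₂ ∘ inj₁

  diag-injective : InjectiveOn S diag
  diag-injective p∈S q∈S = collinear p∈S q∈S ∘ inj₂ ∘ inj₂ ∘ inj₁

  anti-injective : InjectiveOn S anti
  anti-injective p∈S q∈S = collinear p∈S q∈S ∘ inj₂ ∘ inj₂ ∘ inj₂

  Col Row Diag Anti : ℤ → Set ℓ
  Col  = Occupied S col
  Row  = Occupied S row
  Diag = Occupied S diag
  Anti = Occupied S anti

  On : (ℤ × ℤ → ℤ) → ℤ × ℤ → Pred (ℤ × ℤ) ℓ
  On f v = S ∩ Fibre f (f v)

  neighbours : ∀ {v} → v ∉ S → ∀ p →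
    p ∈ (Graph.N (Queen (Side ⟨×⟩ Side)) v ∩ S) ⇔
    p ∈ (On col v ∪ (On row v ∪ (On diag v ∪ On anti v)))
  neighbours v∉S p = mk⇔
    (λ ((_ , v~p) , p∈S) →
      Sum.map (p∈S ,_) (Sum.map (p∈S ,_) (Sum.map (p∈S ,_) (p∈S ,_))) (adjacent⇒onLine v~p))
    λ on → let p∈S , line = split on in
      (subset p∈S , onLine⇒adjacent (λ { refl → v∉S p∈S }) line) , p∈S
    where
    split : ∀ {v p} → p ∈ (On col v ∪ (On row v ∪ (On diag v ∪ On anti v))) → p ∈ S × OnLine v p
    split (inj₁ (p∈S , e))               = p∈S , inj₁ e
    split (inj₂ (inj₁ (p∈S , e)))        = p∈S , inj₂ (inj₁ e)
    split (inj₂ (inj₂ (inj₁ (p∈S , e)))) = p∈S , inj₂ (inj₂ (inj₁ e))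
    split (inj₂ (inj₂ (inj₂ (p∈S , e)))) = p∈S , inj₂ (inj₂ (inj₂ e))

  module _ {x y : ℤ} (v∉S : (x , y) ∉ S) {s t d a : Bool}
           (col? : Reflects (Col x) s) (row? : Reflects (Row y) t)
           (diag? : Reflects (Diag (y - x)) d) (anti? : Reflects (Anti (y + x)) a) where

    private
      v = x , y

      off : ∀ {p} → p ∈ S → p ≢ v
      off p∈S refl = v∉S p∈S

    -- Two of the four sets could share only `v`, which is off `S`, so their sizes add up.
    hasSize-neighbours :
      HasSize (On col v ∪ (On row v ∪ (On diag v ∪ On anti v)))
              (indicator s ℕ.+ (indicator t ℕ.+ (indicator d ℕ.+ indicator a)))
    hasSize-neighbours =
      hasSize-∪ (hasSize-fibre col-injective col?)
        (hasSize-∪ (hasSize-fibre row-injective row?)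
          (hasSize-∪ (hasSize-fibre diag-injective diag?) (hasSize-fibre anti-injective anti?)
            λ p ((p∈S , e) , (_ , e′)) → off p∈S (diag-anti e e′))
          λ { p ((p∈S , e) , inj₁ (_ , e′)) → off p∈S (row-diag e e′)
            ; p ((p∈S , e) , inj₂ (_ , e′)) → off p∈S (row-anti e e′) })
        λ { p ((p∈S , e) , inj₁ (_ , e′))        → off p∈S (col-row e e′)
          ; p ((p∈S , e) , inj₂ (inj₁ (_ , e′))) → off p∈S (col-diag e e′)
          ; p ((p∈S , e) , inj₂ (inj₂ (_ , e′))) → off p∈S (col-anti e e′) }

    -- An occupied column or row provides a neighbour in `S` and so excludes the empty case of
    -- `odd`. In the other case uniqueness of size makes the sum of the four indicators odd.
    odd-lines : x ∈ Side → y ∈ Side → Col x ⊎ Row y → s xor (t xor (d xor a)) ≡ true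
    odd-lines x∈ y∈ occupied with odd v (x∈ , y∈) v∉S
    ... | inj₁ empty = contradiction (neighbour occupied) λ (p , p∈) → empty p p∈
      where
      neighbour : Col x ⊎ Row y → Satisfiable (Graph.N (Queen (Side ⟨×⟩ Side)) v ∩ S)
      neighbour (inj₁ (p , on)) = p , Equivalence.from (neighbours v∉S p) (inj₁ on)
      neighbour (inj₂ (p , on)) = p , Equivalence.from (neighbours v∉S p) (inj₂ (inj₁ on))
    ... | inj₂ (n , odd-n , size-n) = trans (sym odd?-sum) (odd?-Odd
            (subst Odd (hasSize-unique size-n hasSize-neighbours (neighbours v∉S)) odd-n))
      where
      odd?-sum : odd? (indicator s ℕ.+ (indicator t ℕ.+ (indicator d ℕ.+ indicator a)))
                 ≡ s xor (t xor (d xor a))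
      odd?-sum
        rewrite odd?-+ (indicator s) (indicator t ℕ.+ (indicator d ℕ.+ indicator a))
              | odd?-+ (indicator t) (indicator d ℕ.+ indicator a)
              | odd?-+ (indicator d) (indicator a)
              | odd?-indicator s | odd?-indicator t | odd?-indicator d | odd?-indicator a = refl

  -- Swapping the coordinates exchanges columns with rows, fixes antidiagonals and negates diagonal
  -- indices, so the results on columns carry over to rows.
  reflected : (ℤ → Set ℓ) → ℤ → Set ℓ
  reflected D k = D (- k)

  -- The threshold `∣ y₀ ∣` keeps `(x , y)` apart from `p`, the only point of `S` in its column. The
  -- occupied column contributes one to an odd total, so the other three lines add up to zero.
  column-balanced : ∀ {p} → p ∈ S → Balanced Row Diag Anti (col p)
  column-balanced {x , y₀} p∈S = ∣ y₀ ∣ , λ {y} (y∈ , far) k →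
    ¬¬reflects (Row y) λ (t , row?) →
    ¬¬reflects (Diag (y - x)) λ (d , diag?) →
    ¬¬reflects (Anti (y + x)) λ (a , anti?) →
    same-truth row? (⊕-reflects diag? anti?)
      (odd-occupied-column t (d xor a)
        (odd-lines (λ v∈S → ℕ.<-irrefl (cong (∣_∣ ∘ row) (col-injective p∈S v∈S refl)) far)
          (ofʸ (_ , p∈S , refl)) row? diag? anti?
          (proj₁ (subset p∈S)) y∈ (inj₁ (_ , p∈S , refl)))) k

  row-balanced : ∀ {p} → p ∈ S → Balanced Col (reflected Diag) Anti (row p)
  row-balanced {x₀ , y} p∈S = ∣ x₀ ∣ , λ {x} (x∈ , far) k →
    ¬¬reflects (Col x) λ (s , col?) →
    ¬¬reflects (Diag (y - x)) λ (d , diag?) →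
    ¬¬reflects (Anti (y + x)) λ (a , anti?) →
    same-truth col?
      (⊕-reflects (subst (λ i → Reflects (Diag i) d) (lemma x y) diag?)
                  (subst (λ i → Reflects (Anti i) a) (ℤ.+-comm y x) anti?))
      (odd-occupied-row s (d xor a)
        (odd-lines (λ v∈S → ℕ.<-irrefl (cong (∣_∣ ∘ col) (row-injective p∈S v∈S refl)) far)
          col? (ofʸ (_ , p∈S , refl)) diag? anti?
          x∈ (proj₂ (subset p∈S)) (inj₂ (_ , p∈S , refl)))) k
    where
    lemma : ∀ x y → y - x ≡ - (x - y)
    lemma = solve-∀

  not-all-lines : ∀ {x y} → (x , y) ∉ S → x ∈ Side → y ∈ Side →
    Col x → Row y → Diag (y - x) → Anti (y + x) → ⊥
  not-all-lines v∉S x∈ y∈ c r d a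
    with () ← odd-lines v∉S (ofʸ c) (ofʸ r) (ofʸ d) (ofʸ a) x∈ y∈ (inj₁ c)

  -- Contradiction from a common period.

  module _ (M : ℤ) where

    -- Rows need both signs because the point moves by either `(M , M)` or `(M , - M)`.
    RowColPeriodic : ℤ → Set ℓ
    RowColPeriodic z = Col z ≈ Col (z + M) × Row z ≈ Row (z + M) × Row z ≈ Row (z + - M)

    DiagonalPeriodic : ℤ → Set ℓ
    DiagonalPeriodic z = Anti z ≈ Anti (z + (M + M)) × Diag z ≈ Diag (z + - (M + M))

  ¬periodic : Infinite S → ∀ {M} → M ≢ 0ℤ →
    Eventually (RowColPeriodic M) → Eventually (DiagonalPeriodic M) → ⊥
  ¬periodic infinite {M} M≢0 rowCol diagonal =
    let T , good = zipWith (λ z → _,_) (zipWith (λ z → _,_) rowCol diagonal)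
                     (zipWith (λ z → _,_) (shift M inSide) (shift (- M) inSide))
    in ¬¬far-point _≟_ infinite col-injective row-injective T
       λ ((x , y) , p∈S , T<x , T<y) →
       let x∈ , y∈ = subset p∈S
           ((colₓ , _) , _) , (x+M∈ , _) = good (x∈ , T<x)
           ((_ , rowʸ₊ , rowʸ₋) , _) , (y+M∈ , y-M∈) = good (y∈ , T<y)
           occupied : ∀ f → Occupied S f (f (x , y))
           occupied f = (x , y) , p∈S , refl
       in transfer (occupied col) colₓ λ c → case spread T (x∈ , T<x) (y∈ , T<y) of λ
          -- Moving by `(M , M)` keeps the diagonal, so the new vertex is off `S`; the antidiagonal
          -- index grows by `M + M` and stays occupied by periodicity at `y + x`.
          { (inj₁ far) →
              transfer (occupied row) rowʸ₊ λ r →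
              transfer (occupied anti) (proj₁ (proj₂ (proj₁ (good far)))) λ a →
              not-all-lines
                (λ q∈S → moved x (cong col (diag-injective p∈S q∈S (diag-fixed x y M))))
                x+M∈ y+M∈ c r
                (subst Diag (diag-fixed x y M) (occupied diag)) (subst Anti (anti-moved x y M) a)
          -- Moving by `(M , - M)` keeps the antidiagonal instead, and periodicity is applied at the
          -- diagonal index `y - x`.
          ; (inj₂ far) →
              transfer (occupied row) rowʸ₋ λ r →
              transfer (occupied diag) (proj₂ (proj₂ (proj₁ (good far)))) λ d →
              not-all-lines
                (λ q∈S → moved x (cong col (anti-injective p∈S q∈S (anti-fixed x y M))))
                x+M∈ y-M∈ c r
                (subst Diag (diag-moved x y M) d) (subst Anti (anti-fixed x y M) (occupied anti))
          }
    where
    inSide : Eventually Side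
    inSide = 0 , proj₁
    moved : ∀ x → x ≢ x + M
    moved x x≡x+M = M≢0 (ℤ+.∙-cancelˡ x M 0ℤ (trans (sym x≡x+M) (sym (ℤ.+-identityʳ x))))
    diag-fixed : ∀ x y M → y - x ≡ y + M - (x + M)
    diag-fixed = solve-∀
    anti-moved : ∀ x y M → y + x + (M + M) ≡ y + M + (x + M)
    anti-moved = solve-∀
    anti-fixed : ∀ x y M → y + x ≡ y + - M + (x + M)
    anti-fixed = solve-∀
    diag-moved : ∀ x y M → y - x + - (M + M) ≡ y + - M - (x + M)
    diag-moved = solve-∀

  ¬infinite : ¬ Infinite S
  ¬infinite infinite =
    -- Strictly increasing absolute values make the three columns pairwise distinct, and likewise
    -- the three rows, so both common periods are nonzero.
    further 0 0 λ (p , p∈S , _) →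
    further ∣ col p ∣ ∣ row p ∣ λ (q , q∈S , colp<colq , rowp<rowq) →
    further ∣ col q ∣ ∣ row q ∣ λ (r , r∈S , colq<colr , rowq<rowr) →
    let m = commonPeriod (row p) (row q) (row r)
        n = commonPeriod (col p) (col q) (col r)
        -- Three rows give `Col` the period `m + m`, and three columns give `Row`, `Diag` and `Anti`
        -- the period `n + n`; the product is a multiple of both.
        M = (m + m) * (n + n)
        Col-period , _ , _ =
          balanced³-periods Col (reflected Diag) Anti
            (row-balanced p∈S) (row-balanced q∈S) (row-balanced r∈S)
        Row-period , Diag-period , Anti-period =
          balanced³-periods Row Diag Anti
            (column-balanced p∈S) (column-balanced q∈S) (column-balanced r∈S)
        Col-M = subst (Period Col) (ℤ.*-comm (n + n) (m + m))
                  (period-* Col (m + m) Col-period (n + n))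
        Row-M = period-* Row (n + n) Row-period (m + m)
        Anti-2M = period-double-of Anti M (period-* Anti (n + n) Anti-period (m + m))
        Diag-2M = period-double-of Diag M (period-* Diag (n + n) Diag-period (m + m))
    in ¬periodic infinite {M}
         (*-nonZero (m + m) (n + n)
           (double-nonZero m (commonPeriod-nonZero (row p) (row q) (row r) rowp<rowq rowq<rowr))
           (double-nonZero n (commonPeriod-nonZero (col p) (col q) (col r) colp<colq colq<colr)))
         (zipWith (λ z → _,_) Col-M (zipWith (λ z → _,_) Row-M (period-neg Row M Row-M)))
         (zipWith (λ z → _,_) Anti-2M (period-neg Diag (M + M) Diag-2M))
    where
    double-nonZero : ∀ i → i ≢ 0ℤ → i + i ≢ 0ℤ
    double-nonZero i i≢0 = i≢0 ∘ double-injective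
    period-double-of : ∀ f d → Period f d → Period f (d + d)
    period-double-of f d e = subst (Period f) (lemma d) (period-* f d e (+ 2))
      where
      lemma : ∀ d → + 2 * d ≡ d + d
      lemma = solve-∀
    further : ∀ T T′ → ¬ ¬ (∃[ p ] p ∈ S × T ℕ.< ∣ col p ∣ × T′ ℕ.< ∣ row p ∣)
    further T T′ = ¬¬-map
      (λ (p , p∈S , T<x , T<y) → p , p∈S ,
        ℕ.≤-<-trans (ℕ.m≤m+n T T′) T<x , ℕ.≤-<-trans (ℕ.m≤n+m T′ T) T<y)
      (¬¬far-point _≟_ infinite col-injective row-injective (T ℕ.+ T′))

-- The quadrant and the plane.

ℕ⁺-step : ∀ k {z} → z ∈ ℕ⁺ → ∣ k ∣ ℕ.< ∣ z ∣ → z + k ∈ ℕ⁺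
ℕ⁺-step (+ k)    (+≤+ 1≤m) _ = +≤+ (ℕ.≤-trans 1≤m (ℕ.m≤m+n _ k))
ℕ⁺-step -[1+ k ] (+≤+ {n = m} 1≤m) k<m =
  subst ℕ⁺ (sym (ℤ.⊖-≥ (ℕ.<⇒≤ k<m))) (+≤+ (ℕ.m<n⇒0<n∸m k<m))

-- The sum is positive and at least `y`, whereas the difference may leave `ℕ⁺`.
ℕ⁺-spread : ∀ T {x y} → Far ℕ⁺ T x → Far ℕ⁺ T y → Far ℕ⁺ T (y + x) ⊎ Far ℕ⁺ T (y - x)
ℕ⁺-spread T (+≤+ {n = m} _ , _) (+≤+ 1≤n , T<n) =
  inj₁ (+≤+ (ℕ.≤-trans 1≤n (ℕ.m≤m+n _ m)) , ℕ.<-≤-trans T<n (ℕ.m≤m+n _ m))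

-- The sum and the difference add up to `y + y`, whose absolute value exceeds `T + T`, so they
-- cannot both be at most `T` in absolute value.
ℤ-spread : ∀ T {x y} → Far U T x → Far U T y → Far U T (y + x) ⊎ Far U T (y - x)
ℤ-spread T {x} {y} _ (_ , T<y) with T ℕ.<? ∣ y + x ∣ | T ℕ.<? ∣ y - x ∣
... | yes T<s | _       = inj₁ (tt , T<s)
... | no _    | yes T<d = inj₂ (tt , T<d)
... | no T≮s  | no T≮d  = contradiction (begin-strict
  T ℕ.+ T                       <⟨ ℕ.+-mono-< T<y T<y ⟩
  ∣ y ∣ ℕ.+ ∣ y ∣               ≡⟨ lemma₁ y ⟨
  ∣ y + y ∣                     ≡⟨ cong ∣_∣ (lemma₂ x y) ⟩
  ∣ (y + x) + (y - x) ∣         ≤⟨ ℤ.∣i+j∣≤∣i∣+∣j∣ (y + x) (y - x) ⟩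
  ∣ y + x ∣ ℕ.+ ∣ y - x ∣       ≤⟨ ℕ.+-mono-≤ (ℕ.≮⇒≥ T≮s) (ℕ.≮⇒≥ T≮d) ⟩
  T ℕ.+ T                       ∎) (ℕ.<-irrefl refl)
  where
  open ℕ.≤-Reasoning
  lemma₁ : ∀ y → ∣ y + y ∣ ≡ ∣ y ∣ ℕ.+ ∣ y ∣
  lemma₁ (+ n)    = refl
  lemma₁ -[1+ n ] = cong suc (sym (ℕ.+-suc n n))
  lemma₂ : ∀ x y → y + y ≡ (y + x) + (y - x)
  lemma₂ = solve-∀

theorem11 : ∀ {ℓ} (B : Board) → B ≡ ℕ×ℕ ⊎ B ≡ ℤ×ℤ →
    ¬ (∃ λ (S : Pred (ℤ × ℤ) ℓ) → IsOddIndependent (Queen B) S × Infinite S)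
theorem11 B (inj₁ refl) (S , oddIndependent , infinite) =
  Placement.¬infinite ℕ⁺ ℕ⁺-step ℕ⁺-spread oddIndependent infinite
theorem11 B (inj₂ refl) (S , oddIndependent , infinite) =
  Placement.¬infinite U (λ _ _ _ → tt) ℤ-spread oddIndependent infinite
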